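{- Let $\big((a_1,\dots,a_k),(b_1,\dots,b_\ell)\big)$ be a bipartite degree sequence with $\ell\le k$. Let $n'=2\ell$, $m=\sum_{i=1}^k a_i$ and $m^*=2\sum_{i=1}^k\min(a_i,\ell-a_i)$. Then for all pairs of realizations $B_1,B_2$ of this bipartite degree sequence, $$\mathbf{dist}_u(B_1,B_2)\le H'(B_1,B_2)\cdot(1-2/n')\le m^*(1/2-1/n')\le m(1-2/n').$$
   Context: Bipartite graphs are finite and simple, with fixed labeled vertex classes $U=\{u_1,\dots,u_k\}$ and $W=\{w_1,\dots,w_\ell\}$. The bipartite degree sequence of $B$ is $\big((d(u_1),\dots,d(u_k)),(d(w_1),\dots,d(w_\ell))\big)$; $B$ is then a realization of it. Swap (bipartite): if $a,b\in U$ are different, $c,d\in W$ are different, $(a,c),(b,d)\in E(B)$ and $(b,c),(a,d)\notin E(B)$, then a swap replaces the edges $(a,c),(b,d)$ by $(b,c),(a,d)$. $\mathbf{dist}_u(B_1,B_2)$ is the length (number of swaps) of a shortest sequence of such swaps transforming $B_1$ into $B_2$. $H'(B_1,B_2)=|E(B_1)\,\Delta\, E(B_2)|/2$, where $\Delta$ is the symmetric difference. -}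

module Defs where

open import Data.Bool.Base using (_xor_)
open import Data.Fin.Base using (Fin)
open import Data.Fin.Subset using (Subset; inside; outside; _∈_; _∉_; ∣_∣)
open import Data.Integer.Base using (+_)
open import Data.Nat.Base using (ℕ; zero; suc; _*_; _∸_; _⊓_; _≤_)
open import Data.Product.Base using (_×_; _,_)
open import Data.Rational.Base using (ℚ; _/_)
open import Data.Vec.Base using (Vec; map; lookup; zipWith; transpose; sum; _[_]≔_; _[_]%=_)
open import Relation.Binary.PropositionalEquality.Core using (_≡_; _≢_)

private
  variable
    k ℓ : ℕ

-- The labelled classes are U = Fin k and W = Fin ℓ.  A graph lists the
-- neighbourhood (a subset of W) of each u ∈ U, i.e. it is a biadjacency matrix,
-- so _≡_ is equality of labelled graphs.
BipartiteGraph : ℕ → ℕ → Set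
BipartiteGraph k ℓ = Vec (Subset ℓ) k

Edge : BipartiteGraph k ℓ → Fin k → Fin ℓ → Set
Edge B u w = w ∈ lookup B u

NonEdge : BipartiteGraph k ℓ → Fin k → Fin ℓ → Set
NonEdge B u w = w ∉ lookup B u

addEdge : Fin k → Fin ℓ → BipartiteGraph k ℓ → BipartiteGraph k ℓ
addEdge u w B = B [ u ]%= (_[ w ]≔ inside)

removeEdge : Fin k → Fin ℓ → BipartiteGraph k ℓ → BipartiteGraph k ℓ
removeEdge u w B = B [ u ]%= (_[ w ]≔ outside)

-- The rows of the transpose are the neighbourhoods (in U) of the w ∈ W.
degreeSequence : BipartiteGraph k ℓ → Vec ℕ k × Vec ℕ ℓ
degreeSequence B = map ∣_∣ B , map ∣_∣ (transpose B)

Realizes : BipartiteGraph k ℓ → Vec ℕ k × Vec ℕ ℓ → Set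
Realizes B s = degreeSequence B ≡ s

record Swap (B B′ : BipartiteGraph k ℓ) : Set where
  field
    {a b}  : Fin k
    {c d}  : Fin ℓ
    a≢b    : a ≢ b
    c≢d    : c ≢ d
    ac∈E   : Edge B a c
    bd∈E   : Edge B b d
    bc∉E   : NonEdge B b c
    ad∉E   : NonEdge B a d
    result : B′ ≡ addEdge a d (addEdge b c (removeEdge b d (removeEdge a c B)))

infixr 5 _∷_

data SwapSequence {k ℓ : ℕ} : BipartiteGraph k ℓ → BipartiteGraph k ℓ → ℕ → Set where
  []  : ∀ {B} → SwapSequence B B zero
  _∷_ : ∀ {B₁ B₂ B₃ n} → Swap B₁ B₂ → SwapSequence B₂ B₃ n → SwapSequence B₁ B₃ (suc n)

-- Membership of d in the graph of the (a priori partial) function dist_u.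
record IsSwapDistance (B₁ B₂ : BipartiteGraph k ℓ) (d : ℕ) : Set where
  field
    attained : SwapSequence B₁ B₂ d
    minimal  : ∀ {n} → SwapSequence B₁ B₂ n → d ≤ n

-- The edge set of the result is E(B₁) Δ E(B₂).
symmetricDifference : BipartiteGraph k ℓ → BipartiteGraph k ℓ → BipartiteGraph k ℓ
symmetricDifference = zipWith (zipWith _xor_)

edgeCount : BipartiteGraph k ℓ → ℕ
edgeCount B = sum (map ∣_∣ B)

H′ : BipartiteGraph k ℓ → BipartiteGraph k ℓ → ℚ
H′ B₁ B₂ = + edgeCount (symmetricDifference B₁ B₂) / 2

-- The truncated subtraction is exact for realizable sequences, where a_i ≤ ℓ.
m* : Vec ℕ k → ℕ → ℕ
m* as ℓ = 2 * sum (map (λ aᵢ → aᵢ ⊓ (ℓ ∸ aᵢ)) as)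

fromℕ : ℕ → ℚ
fromℕ n = + n / 1

{-# OPTIONS --safe #-}

-- Every vertex meets as many edges of B₁ ∖ B₂ as of B₂ ∖ B₁, so if B₁ ≠ B₂ then
-- a walk alternating between the two can always be continued and closes to an
-- alternating cycle with s ≤ ℓ vertices in each class. Any alternating cycle of
-- length 2s can be flipped by s − 1 swaps, by induction along a chord. Flipping it
-- lowers H′ by s at the cost of s − 1 ≤ s (1 − 1/ℓ) swaps, so repeating this
-- reaches B₂ within H′ (1 − 1/ℓ) swaps. The other two inequalities are
-- |X Δ Y| ≤ 2 min(a, ℓ − a) for a-element subsets X, Y of W, and min(a, ℓ − a) ≤ a.

module Submission where

open import Defs
open import Algebra.Properties.CommutativeMonoid.Sum using ()
open import Algebra.Properties.Group using ()
open import Algebra.Properties.Semiring.Sum using ()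
open import Data.Bool.Base using (Bool; true; false; not; _∧_; _xor_; if_then_else_)
import Data.Bool.Properties as Bool
open import Data.Empty using (⊥; ⊥-elim)
open import Data.Fin.Base using (Fin; zero; suc)
open import Data.Fin.Properties using (_≟_; any?; injective⇒≤)
open import Data.Fin.Subset using (Subset; ∣_∣; ∁)
open import Data.Fin.Subset.Properties using (∣∁p∣≡n∸∣p∣)
open import Data.Integer.Base as ℤ using (+_)
import Data.Integer.Properties as ℤ
open import Data.List.Base as List using (List; []; _∷_; length; take)
open import Data.List.Membership.Propositional.Properties using (∈-lookup)
open import Data.List.Relation.Unary.All as All using (All; []; _∷_)
import Data.List.Relation.Unary.All.Properties as All
open import Data.List.Relation.Unary.AllPairs as AllPairs using (AllPairs; []; _∷_)
import Data.List.Relation.Unary.AllPairs.Properties as AllPairs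
open import Data.List.Relation.Unary.Any as Any using (Any; here; there)
open import Data.Nat.Base as ℕ using (ℕ; zero; suc; NonZero; _⊓_; _∸_)
open import Data.Nat.Induction using (<-rec)
open import Data.Nat.Properties as ℕ using (m*n≢0)
open import Data.Nat.Tactic.RingSolver using (solve-∀)
open import Data.Product.Base using (_×_; _,_; ∃-syntax; proj₁; proj₂)
open import Data.Rational.Base as ℚ using (ℚ; _/_; _*_; _-_; _≤_; 1ℚ; ½; toℚᵘ)
import Data.Rational.Properties as ℚ
open import Data.Rational.Unnormalised.Base as ℚᵘ using (mkℚᵘ)
import Data.Rational.Unnormalised.Properties as ℚᵘ
open import Data.Sum.Base using (_⊎_; inj₁; inj₂)
open import Data.Vec.Base
  using (Vec; []; _∷_; lookup; tabulate; sum; zipWith; map; transpose; replicate; _⊛_; _[_]%=_; _[_]≔_)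
open import Data.Vec.Properties
  using ( tabulate∘lookup; lookup∘tabulate; tabulate-cong; lookup∘updateAt; lookup∘updateAt′; lookup∘update
        ; lookup∘update′; lookup⇒[]=; []=⇒lookup; ≡-dec; lookup-zipWith; lookup-⊛; lookup-replicate; lookup-map
        ; ∷-injectiveˡ; ∷-injectiveʳ)
open import Function.Base using (_∘_; id)
open import Relation.Binary.PropositionalEquality
open import Relation.Nullary using (Dec; yes; no; does; contradiction)
open import Relation.Nullary.Decidable using (dec-true; dec-false; decidable-stable; map′; _×-dec_; ¬?)
open import Relation.Unary using (Decidable)

open Algebra.Properties.CommutativeMonoid.Sum ℕ.+-0-commutativeMonoid
  using (sum-cong-≗; ∑-distrib-+; sum-replicate-zero) renaming (sum to ∑)
open Algebra.Properties.Semiring.Sum ℕ.+-*-semiring using (*-distribʳ-sum)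

-- Flipping a cycle concerns a single graph. A chord may lie in both graphs, in neither or in only
-- one, so a single swap may touch edges outside the difference; progress is therefore measured per
-- cycle and not per swap. The gain is the one swap saved per cycle, relative to its length, so it
-- is worth `1/ℓ` only if no cycle is longer than `ℓ`: the search must return cycles without
-- repeated vertices, not merely closed alternating walks. Swaps, flips of cycles and differences of
-- graphs are all expressed by addition modulo 2 of Boolean matrices, which turns the chord argument
-- into the cancellation of a term that occurs twice. Since `IsSwapDistance` is a relation, a
-- shortest sequence has to be exhibited. The sequence found by flipping cycles bounds a search over
-- the decidable property of being joined by a given number of swaps.

private
  variable
    k ℓ n : ℕ

-- Graphs as Boolean matrices modulo 2

Matrix : ℕ → ℕ → Set
Matrix k ℓ = Fin k → Fin ℓ → Bool

infixl 6 _⊕_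
infix  4 _≐_

_⊕_ : Matrix k ℓ → Matrix k ℓ → Matrix k ℓ
(M ⊕ N) u w = M u w xor N u w

_≐_ : Matrix k ℓ → Matrix k ℓ → Set
M ≐ N = ∀ u w → M u w ≡ N u w

adj : BipartiteGraph k ℓ → Matrix k ℓ
adj B u w = lookup (lookup B u) w

toGraph : Matrix k ℓ → BipartiteGraph k ℓ
toGraph M = tabulate (λ u → tabulate (M u))

toGraph-cong : {M N : Matrix k ℓ} → M ≐ N → toGraph M ≡ toGraph N
toGraph-cong M≐N = tabulate-cong λ u → tabulate-cong (M≐N u)

toGraph∘adj : (B : BipartiteGraph k ℓ) → toGraph (adj B) ≡ B
toGraph∘adj B = trans (tabulate-cong λ u → tabulate∘lookup (lookup B u)) (tabulate∘lookup B)

adj∘toGraph : (M : Matrix k ℓ) → adj (toGraph M) ≐ M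
adj∘toGraph M u w = trans (cong (λ row → lookup row w) (lookup∘tabulate _ u)) (lookup∘tabulate (M u) w)

adj-injective : {B B′ : BipartiteGraph k ℓ} → adj B ≐ adj B′ → B ≡ B′
adj-injective {B = B} {B′} eq =
  trans (sym (toGraph∘adj B)) (trans (toGraph-cong eq) (toGraph∘adj B′))

δ : Fin n → Fin n → Bool
δ x y = does (x ≟ y)

δ-refl : (x : Fin n) → δ x x ≡ true
δ-refl x = dec-true (x ≟ x) refl

δ-≢ : {x y : Fin n} → x ≢ y → δ x y ≡ false
δ-≢ {x = x} {y} = dec-false (x ≟ y)

-- For `a ≢ b` and `c ≢ d`, the indicator of the four cells that a swap changes. Adding it modulo 2
-- is the whole effect of the swap.
rectangle : Fin k → Fin k → Fin ℓ → Fin ℓ → Matrix k ℓ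
rectangle a b c d u w = (δ a u xor δ b u) ∧ (δ c w xor δ d w)

swapped : Fin k → Fin k → Fin ℓ → Fin ℓ → BipartiteGraph k ℓ → BipartiteGraph k ℓ
swapped a b c d B = addEdge a d (addEdge b c (removeEdge b d (removeEdge a c B)))

Alternating : Matrix k ℓ → Fin k → Fin k → Fin ℓ → Fin ℓ → Set
Alternating M a b c d = M a c ≡ true × M b d ≡ true × M b c ≡ false × M a d ≡ false

adj-setEdge : ∀ (B : BipartiteGraph k ℓ) a c v u w →
              adj (B [ a ]%= (_[ c ]≔ v)) u w ≡ (if δ a u ∧ δ c w then v else adj B u w)
adj-setEdge B a c v u w with a ≟ u
... | no a≢u = cong (λ row → lookup row w) (lookup∘updateAt′ u a (a≢u ∘ sym) B)
... | yes refl with c ≟ w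
...   | yes refl = trans (cong (λ row → lookup row c) (lookup∘updateAt a B)) (lookup∘update c (lookup B a) v)
...   | no c≢w   = trans (cong (λ row → lookup row w) (lookup∘updateAt a B)) (lookup∘update′ (c≢w ∘ sym) (lookup B a) v)

-- Alternation says that each of the four updates writes the negation of the old value, which is
-- what adding `true` does.
adj-swapped : ∀ {a b : Fin k} {c d : Fin ℓ} (B : BipartiteGraph k ℓ) → a ≢ b → c ≢ d →
              Alternating (adj B) a b c d → adj (swapped a b c d B) ≐ adj B ⊕ rectangle a b c d
adj-swapped {a = a} {b} {c} {d} B a≢b c≢d (ac , bd , bc , ad) u w
  rewrite adj-setEdge (addEdge b c (removeEdge b d (removeEdge a c B))) a d true u w
        | adj-setEdge (removeEdge b d (removeEdge a c B)) b c true u w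
        | adj-setEdge (removeEdge a c B) b d false u w
        | adj-setEdge B a c false u w
  with a ≟ u | b ≟ u | c ≟ w | d ≟ w
... | yes refl | yes refl | _        | _        = contradiction refl a≢b
... | yes refl | no _     | yes refl | yes refl = contradiction refl c≢d
... | yes refl | no _     | yes refl | no _     rewrite ac = refl
... | yes refl | no _     | no _     | yes refl rewrite ad = refl
... | yes refl | no _     | no _     | no _     = sym (Bool.xor-identityʳ _)
... | no _     | yes refl | yes refl | yes refl = contradiction refl c≢d
... | no _     | yes refl | yes refl | no _     rewrite bc = refl
... | no _     | yes refl | no _     | yes refl rewrite bd = refl
... | no _     | yes refl | no _     | no _     = sym (Bool.xor-identityʳ _)
... | no _     | no _     | _        | _        = sym (Bool.xor-identityʳ _)

edge : {B : BipartiteGraph k ℓ} → ∀ {u w} → adj B u w ≡ true → Edge B u w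
edge {B = B} {u} {w} = lookup⇒[]= w (lookup B u)

nonEdge : {B : BipartiteGraph k ℓ} → ∀ {u w} → adj B u w ≡ false → NonEdge B u w
nonEdge off on = contradiction (trans (sym off) ([]=⇒lookup on)) λ ()

nonEdge⁻¹ : {B : BipartiteGraph k ℓ} → ∀ {u w} → NonEdge B u w → adj B u w ≡ false
nonEdge⁻¹ {B = B} off = Bool.¬-not (off ∘ edge {B = B})

swap-alternating : {B B′ : BipartiteGraph k ℓ} (σ : Swap B B′) → let open Swap σ in Alternating (adj B) a b c d
swap-alternating {B = B} σ =
  []=⇒lookup ac∈E , []=⇒lookup bd∈E , nonEdge⁻¹ {B = B} bc∉E , nonEdge⁻¹ {B = B} ad∉E
  where open Swap σ

swapAt : ∀ {a b : Fin k} {c d : Fin ℓ} (B : BipartiteGraph k ℓ) → a ≢ b → c ≢ d →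
         Alternating (adj B) a b c d → Swap B (swapped a b c d B)
swapAt B a≢b c≢d (ac , bd , bc , ad) = record
  { a≢b = a≢b ; c≢d = c≢d
  ; ac∈E = edge {B = B} ac ; bd∈E = edge {B = B} bd
  ; bc∉E = nonEdge {B = B} bc ; ad∉E = nonEdge {B = B} ad
  ; result = refl }

matrixSwap : ∀ {a b : Fin k} {c d : Fin ℓ} (M : Matrix k ℓ) → a ≢ b → c ≢ d →
             Alternating M a b c d → Swap (toGraph M) (toGraph (M ⊕ rectangle a b c d))
matrixSwap {a = a} {b} {c} {d} M a≢b c≢d (ac , bd , bc , ad) =
  subst (Swap (toGraph M)) (adj-injective eq) (swapAt (toGraph M) a≢b c≢d alt)
  where
  alt : Alternating (adj (toGraph M)) a b c d
  alt = trans (adj∘toGraph M a c) ac , trans (adj∘toGraph M b d) bd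
      , trans (adj∘toGraph M b c) bc , trans (adj∘toGraph M a d) ad

  eq : adj (swapped a b c d (toGraph M)) ≐ adj (toGraph (M ⊕ rectangle a b c d))
  eq u w = trans (adj-swapped (toGraph M) a≢b c≢d alt u w)
           (trans (cong (_xor rectangle a b c d u w) (adj∘toGraph M u w))
                  (sym (adj∘toGraph (M ⊕ rectangle a b c d) u w)))

-- Flipping alternating cycles by swaps

infixl 5 _∷ʳ_
infixr 5 _++_

_∷ʳ_ : {B₁ B₂ B₃ : BipartiteGraph k ℓ} → SwapSequence B₁ B₂ n → Swap B₂ B₃ → SwapSequence B₁ B₃ (suc n)
[]      ∷ʳ τ = τ ∷ []
(σ ∷ s) ∷ʳ τ = σ ∷ (s ∷ʳ τ)

_++_ : ∀ {m} {B₁ B₂ B₃ : BipartiteGraph k ℓ} →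
       SwapSequence B₁ B₂ m → SwapSequence B₂ B₃ n → SwapSequence B₁ B₃ (m ℕ.+ n)
[]      ++ t = t
(σ ∷ s) ++ t = σ ∷ (s ++ t)

-- A list (u₁,w₁) ∷ … ∷ (uₛ,wₛ) ∷ [] with end point z stands for the walk
-- u₁ w₁ u₂ w₂ … uₛ wₛ z; it is closed when u₁ = z.
Steps : ℕ → ℕ → Set
Steps k ℓ = List (Fin k × Fin ℓ)

start : Fin k → Steps k ℓ → Fin k
start z []            = z
start z ((a , _) ∷ _) = a

-- `P` and `N` are abstract because the search for a cycle needs the two one-sided differences of a
-- pair of graphs, whereas flipping needs only the edges and non-edges of one graph.
data AltWalk (P N : Fin k → Fin ℓ → Set) (z : Fin k) : Steps k ℓ → Set where
  []   : AltWalk P N z []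
  step : ∀ {a c xs} → P a c → N (start z xs) c → AltWalk P N z xs → AltWalk P N z ((a , c) ∷ xs)

-- Each step contributes the two edges of the walk at its W-vertex. They are summed modulo 2, so an
-- edge used twice cancels.
flips : Fin k → Steps k ℓ → Matrix k ℓ
flips z []             u w = false
flips z ((a , c) ∷ xs) u w = ((δ a u xor δ (start z xs) u) ∧ δ c w) xor flips z xs u w

Distinct : Fin k × Fin ℓ → Fin k × Fin ℓ → Set
Distinct (a , c) (a′ , c′) = a ≢ a′ × c ≢ c′

On Off : Matrix k ℓ → Fin k → Fin ℓ → Set
On  M u w = M u w ≡ true
Off M u w = M u w ≡ false

-- The implications are required only in the columns that the walk visits: after a swap in columns
-- `c` and `d`, a walk avoiding these two columns is still alternating.
mapWalk : ∀ {P N P′ N′ : Fin k → Fin ℓ → Set} {z xs} →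
          All (λ (_ , c) → ∀ u → (P u c → P′ u c) × (N u c → N′ u c)) xs →
          AltWalk P N z xs → AltWalk P′ N′ z xs
mapWalk []       []           = []
mapWalk (f ∷ fs) (step p q α) = step (proj₁ (f _) p) (proj₂ (f _) q) (mapWalk fs α)

flips-column : ∀ (z : Fin k) {xs : Steps k ℓ} {w} → All (λ (_ , c) → w ≢ c) xs → ∀ u → flips z xs u w ≡ false
flips-column z {[]}           []            u = refl
flips-column z {(a , c) ∷ xs} (w≢c ∷ w∉xs) u
  rewrite δ-≢ (w≢c ∘ sym) | flips-column z w∉xs u | Bool.∧-zeroʳ (δ a u xor δ (start z xs) u) = refl

xor-true : ∀ {x y} → x ≡ false → y ≡ true → x xor y ≡ true
xor-true refl refl = refl

rectangle-row : ∀ {a b : Fin k} {c d : Fin ℓ} {u} → a ≢ u → b ≢ u → ∀ w → rectangle a b c d u w ≡ false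
rectangle-row a≢u b≢u w rewrite δ-≢ a≢u | δ-≢ b≢u = refl

rectangle-column : ∀ {a b : Fin k} {c d : Fin ℓ} {w} → c ≢ w → d ≢ w → ∀ u → rectangle a b c d u w ≡ false
rectangle-column {a = a} {b} c≢w d≢w u rewrite δ-≢ c≢w | δ-≢ d≢w = Bool.∧-zeroʳ (δ a u xor δ b u)

xor-insert : ∀ x y z r → x xor (z xor r) ≡ (x xor y) xor ((y xor z) xor r)
xor-insert x     false z     r = cong (_xor (z xor r)) (sym (Bool.xor-identityʳ x))
xor-insert false true  false r = sym (Bool.not-involutive r)
xor-insert false true  true  r = refl
xor-insert true  true  false r = refl
xor-insert true  true  true  r = Bool.not-involutive r

xor-telescope : ∀ x y z → (x xor y) xor (y xor z) ≡ x xor z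
xor-telescope x false z = cong (_xor z) (Bool.xor-identityʳ x)
xor-telescope false true z = Bool.not-involutive z
xor-telescope true true z = refl

-- The chord `z d` occurs in both terms on the right and cancels. As a modulo 2 identity this holds
-- even when some of the vertices coincide.
shortcut : ∀ (z a : Fin k) (c d : Fin ℓ) xs →
           flips z ((z , c) ∷ (a , d) ∷ xs) ≐ rectangle z a c d ⊕ flips z ((z , d) ∷ xs)
shortcut z a c d xs u w = begin
  za ∧ δ c w xor (as ∧ δ d w xor rest)
    ≡⟨ xor-insert (za ∧ δ c w) (za ∧ δ d w) (as ∧ δ d w) rest ⟩
  (za ∧ δ c w xor za ∧ δ d w) xor ((za ∧ δ d w xor as ∧ δ d w) xor rest)
    ≡⟨ cong₂ (λ x y → x xor (y xor rest)) (Bool.∧-distribˡ-xor za (δ c w) (δ d w))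
                                          (Bool.∧-distribʳ-xor (δ d w) za as) ⟨
  za ∧ (δ c w xor δ d w) xor ((za xor as) ∧ δ d w xor rest)
    ≡⟨ cong (λ x → za ∧ (δ c w xor δ d w) xor (x ∧ δ d w xor rest))
            (xor-telescope (δ z u) (δ a u) (δ (start z xs) u)) ⟩
  za ∧ (δ c w xor δ d w) xor ((δ z u xor δ (start z xs) u) ∧ δ d w xor rest) ∎
  where
  open ≡-Reasoning
  za as rest : Bool
  za   = δ z u xor δ a u
  as   = δ a u xor δ (start z xs) u
  rest = flips z xs u w

-- The first step is kept apart, so that `length xs` is the number of swaps, one less than the
-- number of steps. `M` is universally quantified because the induction may flip the shorter cycle
-- after `M` has been changed by a swap.
FlipsIn : Steps k ℓ → Set
FlipsIn {k} {ℓ} xs = ∀ (M : Matrix k ℓ) {z c} → AltWalk (On M) (Off M) z ((z , c) ∷ xs) →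
  AllPairs Distinct ((z , c) ∷ xs) →
  SwapSequence (toGraph M) (toGraph (M ⊕ flips z ((z , c) ∷ xs))) (length xs)

-- Induction on the length along the chord z d: whichever of the two values the
-- chord has, it splits the cycle into an alternating 4-cycle and an alternating
-- cycle that is one step shorter, and the two flips of the chord cancel.
flipLonger : ∀ {a b : Fin k} {d e : Fin ℓ} {ys} → let xs = (b , e) ∷ ys in
             FlipsIn xs → FlipsIn ((a , d) ∷ xs)
flipLonger {k} {ℓ} {a} {b} {d} {e} {ys} flipShorter M {z} {c} (step zc ac (step ad bd α))
           (((z≢a , c≢d) ∷ z∉xs) ∷ (a∉xs@((a≢b , _) ∷ _) ∷ distinct))
  with M z d in zd
-- The chord is missing, so the swap on the 4-cycle comes first; it creates the edge `z d` from
-- which the shorter cycle starts.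
... | false = subst (λ B → SwapSequence _ B _) (toGraph-cong eq)
                (matrixSwap M z≢a c≢d (zc , ad , ac , zd) ∷ flipShorter M′ α′ distinct′)
  where
  xs : Steps k ℓ
  xs = (b , e) ∷ ys

  M′ : Matrix k ℓ
  M′ = M ⊕ rectangle z a c d

  distinct′ : AllPairs Distinct ((z , d) ∷ xs)
  distinct′ = All.zipWith (λ ((z≢ , _) , (_ , d≢)) → z≢ , d≢) (z∉xs , a∉xs) ∷ distinct

  same : ∀ {u w} → rectangle z a c d u w ≡ false → ∀ {v} → M u w ≡ v → M′ u w ≡ v
  same {u} {w} r Muw rewrite r = trans (Bool.xor-identityʳ (M u w)) Muw

  z≢b : z ≢ b
  z≢b = proj₁ (All.head z∉xs)

  corner : rectangle z a c d z d ≡ true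
  corner rewrite δ-refl z | δ-≢ (z≢a ∘ sym) | δ-≢ c≢d | δ-refl d = refl

  α′ : AltWalk (On M′) (Off M′) z ((z , d) ∷ xs)
  α′ = step (xor-true zd corner) (same (rectangle-row {c = c} {d} z≢b a≢b d) bd)
         (mapWalk (All.zipWith (λ ((_ , c≢) , (_ , d≢)) u →
             same (rectangle-column {a = z} {a} c≢ d≢ u) , same (rectangle-column {a = z} {a} c≢ d≢ u)) (z∉xs , a∉xs)) α)

  eq : M′ ⊕ flips z ((z , d) ∷ xs) ≐ M ⊕ flips z ((z , c) ∷ (a , d) ∷ xs)
  eq u w = trans (Bool.xor-assoc (M u w) _ _) (cong (M u w xor_) (sym (shortcut z a c d xs u w)))
-- The chord is present, so the shorter cycle already alternates. Flipping it removes `z d` and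
-- leaves the other three corners alone, which makes the swap legal.
... | true = subst (λ B → SwapSequence _ B _) (toGraph-cong eq)
               (flipShorter M (step zd bd α) distinct′
                 ∷ʳ matrixSwap M′ z≢a c≢d (same (col c∉ z) zc , same ad′ ad , same (col c∉ a) ac , opposite))
  where
  xs : Steps k ℓ
  xs = (b , e) ∷ ys

  φ M′ : Matrix k ℓ
  φ  = flips z ((z , d) ∷ xs)
  M′ = M ⊕ φ

  distinct′ : AllPairs Distinct ((z , d) ∷ xs)
  distinct′ = All.zipWith (λ ((z≢ , _) , (_ , d≢)) → z≢ , d≢) (z∉xs , a∉xs) ∷ distinct

  same : ∀ {u w} → φ u w ≡ false → ∀ {v} → M u w ≡ v → M′ u w ≡ v
  same {u} {w} r Muw rewrite r = trans (Bool.xor-identityʳ (M u w)) Muw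

  col : ∀ {w} → All (λ (_ , e) → w ≢ e) ((z , d) ∷ xs) → ∀ u → φ u w ≡ false
  col = flips-column z

  c∉ : All (λ (_ , e) → c ≢ e) ((z , d) ∷ xs)
  c∉ = c≢d ∷ All.map proj₂ z∉xs

  tail-d : ∀ u → flips z xs u d ≡ false
  tail-d = flips-column z (All.map proj₂ a∉xs)

  ad′ : φ a d ≡ false
  ad′ rewrite tail-d a | δ-≢ z≢a | δ-≢ (a≢b ∘ sym) = refl

  zd′ : φ z d ≡ true
  zd′ rewrite tail-d z | δ-refl z | δ-≢ (proj₁ (All.head z∉xs) ∘ sym) | δ-refl d = refl

  opposite : M′ z d ≡ false
  opposite = cong₂ _xor_ zd zd′

  eq : M′ ⊕ rectangle z a c d ≐ M ⊕ flips z ((z , c) ∷ (a , d) ∷ xs)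
  eq u w = trans (Bool.xor-assoc (M u w) _ _)
             (cong (M u w xor_) (trans (Bool.xor-comm (φ u w) _) (sym (shortcut z a c d xs u w))))

flipCycle : (xs : Steps k ℓ) → FlipsIn xs
-- `AltCycle` does not exclude a single step, but then `z c` would be both an edge and a non-edge.
flipCycle [] M (step on off []) _ = contradiction (trans (sym on) off) λ ()
flipCycle ((a , d) ∷ []) M {z} {c} (step zc ac (step ad zd [])) (((z≢a , c≢d) ∷ []) ∷ _) =
  subst (λ B → SwapSequence _ B 1) (toGraph-cong eq)
    (matrixSwap M z≢a c≢d (zc , ad , ac , zd) ∷ [])
  where
  eq : M ⊕ rectangle z a c d ≐ M ⊕ flips z ((z , c) ∷ (a , d) ∷ [])
  -- The shorter cycle degenerates to `z d` traversed back and forth and flips nothing.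
  eq u w rewrite shortcut z a c d [] u w | Bool.xor-same (δ z u)
    = cong (M u w xor_) (sym (Bool.xor-identityʳ _))
flipCycle (_ ∷ xs@(_ ∷ _)) = flipLonger (flipCycle xs)

-- Counting the entries of Boolean matrices

bit : Bool → ℕ
bit true  = 1
bit false = 0

count : (Fin n → Bool) → ℕ
count f = ∑ (bit ∘ f)

total : Matrix k ℓ → ℕ
total M = ∑ (λ u → count (M u))

count-cong : {f g : Fin n → Bool} → f ≗ g → count f ≡ count g
count-cong f≗g = sum-cong-≗ (cong bit ∘ f≗g)

total-cong : {M N : Matrix k ℓ} → M ≐ N → total M ≡ total N
total-cong M≐N = sum-cong-≗ (count-cong ∘ M≐N)

bit-xor : ∀ x y → x ∧ y ≡ false → bit (x xor y) ≡ bit x ℕ.+ bit y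
bit-xor false y     _ = refl
bit-xor true  false _ = refl

count-disjoint : (f g : Fin n → Bool) → (∀ x → f x ∧ g x ≡ false) →
                 count (λ x → f x xor g x) ≡ count f ℕ.+ count g
count-disjoint f g f∩g = trans (sum-cong-≗ λ x → bit-xor (f x) (g x) (f∩g x)) (∑-distrib-+ (bit ∘ f) (bit ∘ g))

total-disjoint : (M N : Matrix k ℓ) → (∀ u w → M u w ∧ N u w ≡ false) →
                 total (M ⊕ N) ≡ total M ℕ.+ total N
total-disjoint M N M∩N = trans (sum-cong-≗ λ u → count-disjoint (M u) (N u) (M∩N u))
                               (∑-distrib-+ (count ∘ M) (count ∘ N))

count-false : ∀ n → count {n} (λ _ → false) ≡ 0
count-false n = sum-replicate-zero n

count-δ : (x : Fin n) → count (δ x) ≡ 1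
count-δ {suc n} zero    = cong suc (count-false n)
count-δ {suc n} (suc x) = count-δ x

total-outer : (f : Fin k → Bool) (g : Fin ℓ → Bool) → total (λ u w → f u ∧ g w) ≡ count f ℕ.* count g
total-outer {ℓ = ℓ} f g = trans (sum-cong-≗ λ u → row (f u)) (sym (*-distribʳ-sum (count g) (bit ∘ f)))
  where
  row : ∀ b → count (λ w → b ∧ g w) ≡ bit b ℕ.* count g
  row true  = sym (ℕ.+-identityʳ (count g))
  row false = count-false ℓ

count-toggle : (f : Fin n → Bool) (x : Fin n) → f x ≡ false → count (λ y → f y xor δ x y) ≡ suc (count f)
count-toggle f x fx = trans (count-disjoint f (δ x) disjoint)
                            (trans (cong (count f ℕ.+_) (count-δ x)) (ℕ.+-comm (count f) 1))
  where
  disjoint : ∀ y → f y ∧ δ x y ≡ false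
  disjoint y with x ≟ y
  ... | yes refl = cong (_∧ true) fx
  ... | no _     = Bool.∧-zeroʳ (f y)

-- Both sides exceed by one the count of `g`, which is `f` without `x`.
count-move : ∀ (f : Fin n → Bool) {x y} → f x ≡ true → f y ≡ false →
             count (λ t → f t xor (δ x t xor δ y t)) ≡ count f
count-move f {x} {y} fx fy = begin
  count (λ t → f t xor (δ x t xor δ y t)) ≡⟨ count-cong (λ t → Bool.xor-assoc (f t) (δ x t) (δ y t)) ⟨
  count (λ t → g t xor δ y t)             ≡⟨ count-toggle g y gy ⟩
  suc (count g)                           ≡⟨ count-toggle g x gx ⟨
  count (λ t → g t xor δ x t)             ≡⟨ count-cong undo ⟩
  count f                                 ∎
  where
  open ≡-Reasoning
  g : Fin _ → Bool
  g t = f t xor δ x t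

  x≢y : x ≢ y
  x≢y refl = contradiction (trans (sym fx) fy) λ ()

  gx : g x ≡ false
  gx rewrite fx | δ-refl x = refl

  gy : g y ≡ false
  gy rewrite fy | δ-≢ x≢y = refl

  undo : ∀ t → g t xor δ x t ≡ f t
  undo t = trans (Bool.xor-assoc (f t) (δ x t) (δ x t))
                 (trans (cong (f t xor_) (Bool.xor-same (δ x t))) (Bool.xor-identityʳ (f t)))

Unequal : Bool → Bool → Set
Unequal x y = (x ≡ true × y ≡ false) ⊎ (x ≡ false × y ≡ true)

-- The effect of a swap on one line of the matrix: `b` tells whether the line meets the rectangle,
-- and if it does, exactly one of its two cells is filled.
count-exchange : ∀ (f : Fin n → Bool) {x y} b → (b ≡ true → Unequal (f x) (f y)) →
                 count (λ t → f t xor (b ∧ (δ x t xor δ y t))) ≡ count f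
count-exchange f false _ = count-cong λ t → Bool.xor-identityʳ (f t)
count-exchange f {x} {y} true fx≠fy with fx≠fy refl
... | inj₁ (fx , fy) = count-move f fx fy
... | inj₂ (fx , fy) = trans (count-cong λ t → cong (f t xor_) (Bool.xor-comm (δ x t) (δ y t))) (count-move f fy fx)

-- Degrees: invariance under swaps, surplus and deficit

record SameDegrees (M N : Matrix k ℓ) : Set where
  constructor _,_
  field
    rows    : ∀ u → count (M u) ≡ count (N u)
    columns : ∀ w → count (λ u → M u w) ≡ count (λ u → N u w)

open SameDegrees

SameDegrees-trans : {M N O : Matrix k ℓ} → SameDegrees M N → SameDegrees N O → SameDegrees M O
SameDegrees-trans (r , c) (r′ , c′) = (λ u → trans (r u) (r′ u)) , (λ w → trans (c w) (c′ w))

SameDegrees-sym : {M N : Matrix k ℓ} → SameDegrees M N → SameDegrees N M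
SameDegrees-sym (r , c) = sym ∘ r , sym ∘ c

≐⇒SameDegrees : {M N : Matrix k ℓ} → M ≐ N → SameDegrees M N
≐⇒SameDegrees M≐N = (λ u → count-cong (M≐N u)) , (λ w → count-cong λ u → M≐N u w)

swap-degrees : {B B′ : BipartiteGraph k ℓ} → Swap B B′ → SameDegrees (adj B) (adj B′)
swap-degrees {B = B} σ = subst (SameDegrees (adj B) ∘ adj) (sym result)
  (SameDegrees-trans (SameDegrees-sym (rows′ , columns′))
     (SameDegrees-sym (≐⇒SameDegrees (adj-swapped B a≢b c≢d (swap-alternating σ)))))
  where
  open Swap σ
  rows′ : ∀ u → count ((adj B ⊕ rectangle a b c d) u) ≡ count (adj B u)
  rows′ u = count-exchange (adj B u) (δ a u xor δ b u) unequal
    where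
    unequal : δ a u xor δ b u ≡ true → Unequal (adj B u c) (adj B u d)
    unequal eq with a ≟ u | b ≟ u | swap-alternating σ | eq
    ... | yes refl | no _     | ac , bd , bc , ad | _ = inj₁ (ac , ad)
    ... | no _     | yes refl | ac , bd , bc , ad | _ = inj₂ (bc , bd)

  columns′ : ∀ w → count (λ u → (adj B ⊕ rectangle a b c d) u w) ≡ count (λ u → adj B u w)
  columns′ w = trans (count-cong λ u → cong (adj B u w xor_) (Bool.∧-comm (δ a u xor δ b u) _))
                     (count-exchange (λ u → adj B u w) (δ c w xor δ d w) unequal)
    where
    unequal : δ c w xor δ d w ≡ true → Unequal (adj B a w) (adj B b w)
    unequal eq with c ≟ w | d ≟ w | swap-alternating σ | eq
    ... | yes refl | no _     | ac , bd , bc , ad | _ = inj₁ (ac , bc)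
    ... | no _     | yes refl | ac , bd , bc , ad | _ = inj₂ (ad , bd)

swaps-degrees : {B B′ : BipartiteGraph k ℓ} → SwapSequence B B′ n → SameDegrees (adj B) (adj B′)
swaps-degrees []      = ≐⇒SameDegrees λ _ _ → refl
swaps-degrees (σ ∷ s) = SameDegrees-trans (swap-degrees σ) (swaps-degrees s)

count-positive : (f : Fin n → Bool) (x : Fin n) → f x ≡ true → count f ≢ 0
count-positive f zero    fx eq rewrite fx = contradiction eq λ ()
count-positive f (suc x) fx eq = count-positive (f ∘ suc) x fx (ℕ.m+n≡0⇒n≡0 (bit (f zero)) eq)

-- If g were contained in f, then f would have count (f xor g) > 0 more elements.
surplus⇒deficit : ∀ (f g : Fin n → Bool) {x} → count f ≡ count g → f x ≡ true → g x ≡ false →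
                  ∃[ y ] f y ≡ false × g y ≡ true
surplus⇒deficit f g {x} same fx gx with any? (λ y → (f y Bool.≟ false) ×-dec (g y Bool.≟ true))
... | yes found = found
... | no  none  = contradiction excess≡0 (count-positive excess x (cong₂ _xor_ fx gx))
  where
  excess : Fin _ → Bool
  excess y = f y xor g y

  disjoint : ∀ y → excess y ∧ g y ≡ false
  disjoint y with f y in fy | g y in gy
  ... | false | false = refl
  ... | false | true  = contradiction (y , fy , gy) none
  ... | true  | false = refl
  ... | true  | true  = refl

  restore : ∀ y → excess y xor g y ≡ f y
  restore y = trans (Bool.xor-assoc (f y) (g y) (g y))
                    (trans (cong (f y xor_) (Bool.xor-same (g y))) (Bool.xor-identityʳ (f y)))

  excess≡0 : count excess ≡ 0
  excess≡0 = ℕ.+-cancelʳ-≡ (count g) (count excess) 0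
    (trans (sym (count-disjoint excess g disjoint)) (trans (count-cong restore) same))

-- Size and support of a flipped walk

-- Nothing cancels modulo 2: different steps lie in different columns, and the two edges of one step
-- differ because `P` and `N` exclude each other.
total-flips : ∀ {P N : Fin k → Fin ℓ → Set} → (∀ {u w} → P u w → N u w → ⊥) →
              ∀ {z xs} → AltWalk P N z xs → AllPairs Distinct xs → total (flips z xs) ≡ length xs ℕ.* 2
total-flips {k} {ℓ} P∩N [] [] = trans (sum-cong-≗ {k} λ _ → count-false ℓ) (sum-replicate-zero k)
total-flips {N = N} P∩N {z} {(a , c) ∷ xs} (step p q α) (fresh ∷ distinct) = begin
  total (flips z ((a , c) ∷ xs))       ≡⟨ total-disjoint first (flips z xs) disjoint ⟩
  total first ℕ.+ total (flips z xs)   ≡⟨ cong₂ ℕ._+_ first≡2 (total-flips P∩N α distinct) ⟩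
  2 ℕ.+ length xs ℕ.* 2                ∎
  where
  open ≡-Reasoning
  b : Fin _
  b = start z xs

  first : Matrix _ _
  first u w = (δ a u xor δ b u) ∧ δ c w

  a∧b : ∀ u → δ a u ∧ δ b u ≡ false
  a∧b u with a ≟ u | b ≟ u
  ... | yes refl | yes b≡a = ⊥-elim (P∩N p (subst (λ v → N v c) b≡a q))
  ... | yes refl | no _    = refl
  ... | no _     | _       = refl

  first≡2 : total first ≡ 2
  first≡2 = trans (total-outer (λ u → δ a u xor δ b u) (δ c))
    (cong₂ ℕ._*_ (trans (count-disjoint (δ a) (δ b) a∧b) (cong₂ ℕ._+_ (count-δ a) (count-δ b))) (count-δ c))

  disjoint : ∀ u w → first u w ∧ flips z xs u w ≡ false
  disjoint u w with c ≟ w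
  ... | no _     = cong (_∧ flips z xs u w) (Bool.∧-zeroʳ (δ a u xor δ b u))
  ... | yes refl = trans (cong (_ ∧_) (flips-column z (All.map proj₂ fresh) u)) (Bool.∧-zeroʳ _)

flips⊆ : ∀ {P N : Fin k → Fin ℓ → Set} {z xs} → AltWalk P N z xs →
         ∀ {u w} → flips z xs u w ≡ true → P u w ⊎ N u w
flips⊆ {z = z} {(a , c) ∷ xs} (step p q α) {u} {w} on
  with a ≟ u | start z xs ≟ u | c ≟ w
... | yes refl | _        | yes refl = inj₁ p
... | no _     | yes refl | yes refl = inj₂ q
... | no _     | no _     | _        = flips⊆ α on
... | yes refl | yes _    | no _     = flips⊆ α on
... | yes refl | no _     | no _     = flips⊆ α on
... | no _     | yes refl | no _     = flips⊆ α on

Distinct-lookup : ∀ {xs : Steps k ℓ} → AllPairs Distinct xs →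
                  ∀ {i j} → proj₂ (List.lookup xs i) ≡ proj₂ (List.lookup xs j) → i ≡ j
Distinct-lookup (_ ∷ _)     {zero}  {zero}  _  = refl
Distinct-lookup (fresh ∷ _) {zero}  {suc j} eq = contradiction eq (proj₂ (All.lookup fresh (∈-lookup j)))
Distinct-lookup (fresh ∷ _) {suc i} {zero}  eq = contradiction (sym eq) (proj₂ (All.lookup fresh (∈-lookup i)))
Distinct-lookup (_ ∷ xs!)   {suc i} {suc j} eq = cong suc (Distinct-lookup xs! eq)

length≤ℓ : {xs : Steps k ℓ} → AllPairs Distinct xs → length xs ℕ.≤ ℓ
length≤ℓ xs! = injective⇒≤ (Distinct-lookup xs!)

-- Search for an alternating cycle

module _ {P N : Fin k → Fin ℓ → Set} where

  -- The prefix stops just before the step that leaves `v`, so its last edge already arrives there.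
  -- Distinctness keeps `v` out of the prefix, as is needed to prepend a step at `v`.
  closeAtU : ∀ {v z xs} → Any (λ (a , _) → a ≡ v) xs → AltWalk P N z xs → AllPairs Distinct xs →
             ∃[ n ] AltWalk P N v (take n xs) × start v (take n xs) ≡ start z xs ×
                    All (λ (a , _) → v ≢ a) (take n xs)
  closeAtU (here refl) _ _ = 0 , [] , refl , []
  closeAtU {v} (there v∈xs) (step {c = c} p q α) (fresh ∷ xs!) with closeAtU v∈xs α xs!
  ... | n , α′ , same , v∉ =
    suc n , step p (subst (λ u → N u c) (sym same) q) α′ , refl
          , All.lookupWith (λ (a≢ , _) a≡v v≡a → a≢ (trans (sym v≡a) (sym a≡v))) fresh v∈xs ∷ v∉

  -- The prefix includes the step at `e`, whose second edge is redirected to `v`; hence `suc n`.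
  closeAtW : ∀ {v e z xs} → Any (λ (_ , c) → c ≡ e) xs → N v e → AltWalk P N z xs →
             ∃[ n ] AltWalk P N v (take (suc n) xs) × start v (take (suc n) xs) ≡ start z xs
  closeAtW (here refl)  ve (step p q α) = 0 , step p ve [] , refl
  closeAtW (there e∈xs) ve (step {c = c} p q α) with closeAtW e∈xs ve α
  ... | n , α′ , same = suc n , step p (subst (λ u → N u c) (sym same) q) α′ , refl

  AltCycle : Set
  AltCycle = ∃[ z ] ∃[ c ] ∃[ xs ] AltWalk P N z ((z , c) ∷ xs) × AllPairs Distinct ((z , c) ∷ xs)

  module _ (leave : ∀ {a c} → P a c → ∃[ d ] N a d) (enter : ∀ {a d} → N a d → ∃[ b ] P b d) where

    -- The walk is extended at its front, so both ways of meeting an old vertex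
    -- leave a prefix of it as the alternating cycle.
    extend : ∀ fuel {z a c xs} → AltWalk P N z ((a , c) ∷ xs) → AllPairs Distinct ((a , c) ∷ xs) →
             ℓ ℕ.< fuel ℕ.+ suc (length xs) → AltCycle
    -- `fuel` plus the number of steps stays above `ℓ`, so without fuel the walk would have more
    -- than `ℓ` distinct W-vertices. `findCycle` starts with one step and therefore needs only fuel
    -- `ℓ`.
    extend zero _ ys! long = contradiction long (ℕ.≤⇒≯ (length≤ℓ ys!))
    extend (suc fuel) {z} {a} {c} {xs} α@(step ac _ _) ys! long
      with leave ac
    ... | d , ad with enter ad
    -- If `d` is old, the cycle closes through `a d` without using `b`; only a new `d` permits the
    -- step from `b` through `d` to `a`.
    ... | b , bd with Any.any? (λ (_ , e) → e ≟ d) ((a , c) ∷ xs)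
    ...   | yes d∈ with closeAtW d∈ ad α
    ...     | n , β , _ = a , c , take n xs , β , AllPairs.take⁺ (suc n) ys!
    extend (suc fuel) {z} {a} {c} {xs} α ys! long
      | d , ad | b , bd | no d∉ with Any.any? (λ (u , _) → u ≟ b) ((a , c) ∷ xs)
    ...   | yes b∈ with closeAtU b∈ α ys!
    ...     | n , β , same , b∉ =
      b , d , take n ((a , c) ∷ xs) , step bd (subst (λ u → N u d) (sym same) ad) β
      , All.zipWith (λ (b≢ , ≢d) → b≢ , ≢d ∘ sym) (b∉ , All.take⁺ n (All.¬Any⇒All¬ _ d∉))
        ∷ AllPairs.take⁺ n ys!
    extend (suc fuel) {z} {a} {c} {xs} α ys! long
      | d , ad | b , bd | no d∉ | no b∉ =
      extend fuel (step bd ad α)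
        (All.zipWith (λ (≢b , ≢d) → ≢b ∘ sym , ≢d ∘ sym) (All.¬Any⇒All¬ _ b∉ , All.¬Any⇒All¬ _ d∉) ∷ ys!)
        (subst (ℓ ℕ.<_) (sym (ℕ.+-suc fuel _)) long)

    findCycle : ∀ {a c} → P a c → (∃[ z ] N z c) → AltCycle
    findCycle ac (z , zc) = extend ℓ (step ac zc []) ([] ∷ []) (ℕ.≤-reflexive (ℕ.+-comm 1 ℓ))

-- Descent along the cycles of the difference

differing-edge : (M M′ : Matrix k ℓ) → SameDegrees M M′ →
                 M ≐ M′ ⊎ ∃[ u ] ∃[ w ] M u w ≡ true × M′ u w ≡ false
differing-edge M M′ M~M′ with any? (λ u → any? (λ w → ¬? (M u w Bool.≟ M′ u w)))
... | no same = inj₁ λ u w → decidable-stable (M u w Bool.≟ M′ u w) λ ≢ → same (u , w , ≢)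
... | yes (u , w , M≢M′) with M u w in on | M′ u w in on′
...   | true  | true  = contradiction refl M≢M′
...   | false | false = contradiction refl M≢M′
...   | true  | false = inj₂ (u , w , on , on′)
-- The edge found belongs to `M′` only; equal row degrees give one in the same row that belongs to
-- `M` only.
...   | false | true  with surplus⇒deficit (M′ u) (M u) (sym (rows M~M′ u)) on′ on
...     | w′ , off′ , on″ = inj₂ (u , w′ , on″ , off′)

difference-cycle : (M M′ : Matrix k ℓ) → SameDegrees M M′ → ∀ {u w} → M u w ≡ true → M′ u w ≡ false →
                   AltCycle {P = λ u w → M u w ≡ true × M′ u w ≡ false} {λ u w → M u w ≡ false × M′ u w ≡ true}
difference-cycle M M′ M~M′ {u} {w} on off = findCycle
  (λ {a} (on , off) → surplus⇒deficit (M a) (M′ a) (rows M~M′ a) on off)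
  (λ {_} {d} (off , on) →
    let (b , off′ , on′) = surplus⇒deficit (λ u → M′ u d) (λ u → M u d) (sym (columns M~M′ d)) on off
    in b , on′ , off′)
  (on , off)
  (surplus⇒deficit (λ u → M u w) (λ u → M′ u w) (columns M~M′ w) on off)

-- All flipped edges lie in `M ⊕ M′`, so the difference splits disjointly into the cycle and what
-- remains after the flip.
cycle-distance : ∀ {P N : Fin k → Fin ℓ → Set} (M M′ : Matrix k ℓ) →
  (∀ {u w} → P u w → M u w ≡ true × M′ u w ≡ false) →
  (∀ {u w} → N u w → M u w ≡ false × M′ u w ≡ true) →
  ∀ {z xs} → AltWalk P N z xs → AllPairs Distinct xs →
  total (M ⊕ M′) ≡ total ((M ⊕ flips z xs) ⊕ M′) ℕ.+ length xs ℕ.* 2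
cycle-distance {P = P} {N} M M′ P⊆ N⊆ {z} {xs} α xs! = begin
  total (M ⊕ M′)                          ≡⟨ total-cong restore ⟩
  total (rest ⊕ φ)                        ≡⟨ total-disjoint rest φ disjoint ⟩
  total rest ℕ.+ total φ                  ≡⟨ cong (total rest ℕ.+_) (total-flips exclusive α xs!) ⟩
  total rest ℕ.+ length xs ℕ.* 2          ∎
  where
  open ≡-Reasoning
  φ rest : Matrix _ _
  φ    = flips z xs
  rest = (M ⊕ φ) ⊕ M′

  exclusive : ∀ {u w} → P u w → N u w → ⊥
  exclusive p q = contradiction (trans (sym (proj₁ (P⊆ p))) (proj₁ (N⊆ q))) λ ()

  xor-cancel : ∀ x y f → x xor y ≡ ((x xor f) xor y) xor f
  xor-cancel x y false = sym (trans (Bool.xor-identityʳ _) (cong (_xor y) (Bool.xor-identityʳ x)))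
  xor-cancel false y true = sym (trans (Bool.xor-comm (not y) true) (Bool.not-involutive y))
  xor-cancel true  y true = Bool.xor-comm true y

  restore : M ⊕ M′ ≐ rest ⊕ φ
  restore u w = xor-cancel (M u w) (M′ u w) (φ u w)

  disjoint : ∀ u w → rest u w ∧ φ u w ≡ false
  disjoint u w with φ u w in on
  ... | false = Bool.∧-zeroʳ _
  ... | true  with flips⊆ α {u} {w} on
  ...   | inj₁ p rewrite proj₁ (P⊆ p) | proj₂ (P⊆ p) = refl
  ...   | inj₂ q rewrite proj₁ (N⊆ q) | proj₂ (N⊆ q) = refl

-- The bound is `d ≤ (n/2)(1 - 1/ℓ)`, multiplied by `2ℓ` and freed of subtraction. A cycle of
-- `suc L` steps adds `L` swaps and `2 (suc L)` differing edges, and the increments compare exactly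
-- when `suc L ≤ ℓ`.
add-cycle : ∀ {ℓ d n L} → d ℕ.* ℓ ℕ.* 2 ℕ.+ n ℕ.≤ n ℕ.* ℓ → suc L ℕ.≤ ℓ →
            (L ℕ.+ d) ℕ.* ℓ ℕ.* 2 ℕ.+ (n ℕ.+ suc L ℕ.* 2) ℕ.≤ (n ℕ.+ suc L ℕ.* 2) ℕ.* ℓ
add-cycle {ℓ} {d} {n} {L} ih s≤ℓ = begin
  (L ℕ.+ d) ℕ.* ℓ ℕ.* 2 ℕ.+ (n ℕ.+ suc L ℕ.* 2)               ≡⟨ left L d ℓ n ⟩
  (d ℕ.* ℓ ℕ.* 2 ℕ.+ n) ℕ.+ (L ℕ.* ℓ ℕ.* 2 ℕ.+ suc L ℕ.* 2)
    ≤⟨ ℕ.+-mono-≤ ih (ℕ.+-monoʳ-≤ (L ℕ.* ℓ ℕ.* 2) (ℕ.*-monoˡ-≤ 2 s≤ℓ)) ⟩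
  n ℕ.* ℓ ℕ.+ (L ℕ.* ℓ ℕ.* 2 ℕ.+ ℓ ℕ.* 2)                      ≡⟨ right L ℓ n ⟩
  (n ℕ.+ suc L ℕ.* 2) ℕ.* ℓ                                     ∎
  where
  open ℕ.≤-Reasoning
  left : ∀ L d ℓ n → (L ℕ.+ d) ℕ.* ℓ ℕ.* 2 ℕ.+ (n ℕ.+ suc L ℕ.* 2)
                   ≡ (d ℕ.* ℓ ℕ.* 2 ℕ.+ n) ℕ.+ (L ℕ.* ℓ ℕ.* 2 ℕ.+ suc L ℕ.* 2)
  left = solve-∀
  right : ∀ L ℓ n → n ℕ.* ℓ ℕ.+ (L ℕ.* ℓ ℕ.* 2 ℕ.+ ℓ ℕ.* 2) ≡ (n ℕ.+ suc L ℕ.* 2) ℕ.* ℓ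
  right = solve-∀

Reaches : Matrix k ℓ → Matrix k ℓ → ℕ → Set
Reaches {ℓ = ℓ} M M′ n = ∃[ d ] SwapSequence (toGraph M) (toGraph M′) d × d ℕ.* ℓ ℕ.* 2 ℕ.+ n ℕ.≤ n ℕ.* ℓ

reach : .{{NonZero ℓ}} → (M′ : Matrix k ℓ) →
        ∀ n (M : Matrix k ℓ) → SameDegrees M M′ → total (M ⊕ M′) ≡ n → Reaches M M′ n
reach {ℓ} {k} M′ = <-rec (λ n → ∀ M → SameDegrees M M′ → total (M ⊕ M′) ≡ n → Reaches M M′ n) go
  where
  go : ∀ n → (∀ {m} → m ℕ.< n → ∀ M → SameDegrees M M′ → total (M ⊕ M′) ≡ m → Reaches M M′ m) →
       ∀ M → SameDegrees M M′ → total (M ⊕ M′) ≡ n → Reaches M M′ n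
  go n rec M M~M′ refl with differing-edge M M′ M~M′
  ... | inj₁ M≐M′ = 0 , subst (λ B → SwapSequence _ B 0) (toGraph-cong M≐M′) [] , ℕ.m≤m*n n ℓ
  ... | inj₂ (_ , _ , on , off) with difference-cycle M M′ M~M′ on off
  ...   | z , c , xs , α , xs! = extendBy (rec smaller M₁ M₁~M′ refl)
    where
    M₁ : Matrix k ℓ
    M₁ = M ⊕ flips z ((z , c) ∷ xs)

    shortens : total (M ⊕ M′) ≡ total (M₁ ⊕ M′) ℕ.+ suc (length xs) ℕ.* 2
    shortens = cycle-distance M M′ id id α xs!

    smaller : total (M₁ ⊕ M′) ℕ.< total (M ⊕ M′)
    smaller = subst (total (M₁ ⊕ M′) ℕ.<_) (sym shortens) (ℕ.m<m+n _ (ℕ.s≤s ℕ.z≤n))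

    swaps : SwapSequence (toGraph M) (toGraph M₁) (length xs)
    swaps = flipCycle xs M (mapWalk (All.universal (λ _ _ → proj₁ , proj₁) _) α) xs!

    -- The flip preserves degrees because it has just been realized by swaps.
    M₁~M′ : SameDegrees M₁ M′
    M₁~M′ = SameDegrees-trans (SameDegrees-sym (SameDegrees-trans (≐⇒SameDegrees (λ u w → sym (adj∘toGraph M u w)))
      (SameDegrees-trans (swaps-degrees swaps) (≐⇒SameDegrees (adj∘toGraph M₁))))) M~M′

    extendBy : Reaches M₁ M′ (total (M₁ ⊕ M′)) → Reaches M M′ (total (M ⊕ M′))
    extendBy (d , s , d≤) = length xs ℕ.+ d , swaps ++ s ,
      subst (λ n → (length xs ℕ.+ d) ℕ.* ℓ ℕ.* 2 ℕ.+ n ℕ.≤ n ℕ.* ℓ) (sym shortens)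
        (add-cycle {ℓ} {d} {L = length xs} d≤ (length≤ℓ xs!))

-- Existence of a shortest swap sequence

-- The four vertices determine a swap and its result, so each first swap can be tried in turn.
-- Decidability is what lets `least` pass from some length to the minimal one.
swapSequence? : ∀ n (B B′ : BipartiteGraph k ℓ) → Dec (SwapSequence B B′ n)
swapSequence? zero    B B′ = map′ (λ { refl → [] }) (λ { [] → refl }) (≡-dec (≡-dec Bool._≟_) B B′)
swapSequence? (suc n) B B′ = map′
  (λ (a , b , c , d , a≢b , c≢d , alt , s) → swapAt B a≢b c≢d alt ∷ s)
  (λ { (σ ∷ s) → let open Swap σ in
       a , b , c , d , a≢b , c≢d , swap-alternating σ , subst (λ B → SwapSequence B B′ n) result s })
  (any? λ a → any? λ b → any? λ c → any? λ d →
    ¬? (a ≟ b) ×-dec ¬? (c ≟ d)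
    ×-dec ((adj B a c Bool.≟ true) ×-dec (adj B b d Bool.≟ true)
           ×-dec (adj B b c Bool.≟ false) ×-dec (adj B a d Bool.≟ false))
    ×-dec swapSequence? n (swapped a b c d B) B′)

least : ∀ {P : ℕ → Set} → Decidable P → ∀ n → P n → ∃[ m ] P m × m ℕ.≤ n × (∀ {i} → P i → m ℕ.≤ i)
least {P} P? = <-rec _ go
  where
  go : ∀ n → (∀ {m} → m ℕ.< n → P m → ∃[ l ] P l × l ℕ.≤ m × (∀ {i} → P i → l ℕ.≤ i)) →
       P n → ∃[ l ] P l × l ℕ.≤ n × (∀ {i} → P i → l ℕ.≤ i)
  go n rec Pn with ℕ.anyUpTo? P? n
  ... | no none = n , Pn , ℕ.≤-refl , λ {i} Pi → ℕ.≮⇒≥ λ i<n → none (i , i<n , Pi)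
  ... | yes (m , m<n , Pm) with rec m<n Pm
  ...   | l , Pl , l≤m , minimal = l , Pl , ℕ.≤-trans l≤m (ℕ.<⇒≤ m<n) , minimal

-- From vectors to matrices: edge counts and degree sequences

count-lookup : (p : Subset n) → ∣ p ∣ ≡ count (lookup p)
count-lookup []          = refl
count-lookup (true ∷ p)  = cong suc (count-lookup p)
count-lookup (false ∷ p) = count-lookup p

edgeCount-total : (B : BipartiteGraph k ℓ) → edgeCount B ≡ total (adj B)
edgeCount-total []      = refl
edgeCount-total (p ∷ B) = cong₂ ℕ._+_ (count-lookup p) (edgeCount-total B)

adj-symmetricDifference : (B₁ B₂ : BipartiteGraph k ℓ) → adj (symmetricDifference B₁ B₂) ≐ adj B₁ ⊕ adj B₂
adj-symmetricDifference B₁ B₂ u w =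
  trans (cong (λ row → lookup row w) (lookup-zipWith (zipWith _xor_) u B₁ B₂))
        (lookup-zipWith _xor_ w (lookup B₁ u) (lookup B₂ u))

lookup-transpose : ∀ (p : Subset ℓ) (B : BipartiteGraph k ℓ) w →
                   lookup (transpose (p ∷ B)) w ≡ lookup p w ∷ lookup (transpose B) w
lookup-transpose {ℓ} {k} p B w = begin
  lookup (transpose (p ∷ B)) w                          ≡⟨ lookup-⊛ w (replicate ℓ cons ⊛ p) (transpose B) ⟩
  lookup (replicate ℓ cons ⊛ p) w row                   ≡⟨ cong (λ f → f row) (lookup-⊛ w (replicate ℓ cons) p) ⟩
  lookup (replicate ℓ cons) w (lookup p w) row          ≡⟨ cong (λ f → f (lookup p w) row) (lookup-replicate w cons) ⟩
  lookup p w ∷ row                                      ∎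
  where
  open ≡-Reasoning
  cons : Bool → Vec Bool k → Vec Bool (suc k)
  cons = Vec._∷_

  row : Vec Bool k
  row = lookup (transpose B) w

adj-transpose : (B : BipartiteGraph k ℓ) → ∀ u w → lookup (lookup (transpose B) w) u ≡ adj B u w
adj-transpose (p ∷ B) zero    w = cong (λ row → lookup row zero) (lookup-transpose p B w)
adj-transpose (p ∷ B) (suc u) w =
  trans (cong (λ row → lookup row (suc u)) (lookup-transpose p B w)) (adj-transpose B u w)

realizations-SameDegrees : {B₁ B₂ : BipartiteGraph k ℓ} → degreeSequence B₁ ≡ degreeSequence B₂ →
                           SameDegrees (adj B₁) (adj B₂)
realizations-SameDegrees {k} {ℓ} {B₁} {B₂} same = rows′ , columns′
  where
  open ≡-Reasoning
  degrees : ∀ {m n} {C D : Vec (Subset n) m} → map ∣_∣ C ≡ map ∣_∣ D →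
            ∀ i → count (lookup (lookup C i)) ≡ count (lookup (lookup D i))
  degrees {C = C} {D} eq i = begin
    count (lookup (lookup C i)) ≡⟨ count-lookup (lookup C i) ⟨
    ∣ lookup C i ∣              ≡⟨ lookup-map i ∣_∣ C ⟨
    lookup (map ∣_∣ C) i        ≡⟨ cong (λ v → lookup v i) eq ⟩
    lookup (map ∣_∣ D) i        ≡⟨ lookup-map i ∣_∣ D ⟩
    ∣ lookup D i ∣              ≡⟨ count-lookup (lookup D i) ⟩
    count (lookup (lookup D i)) ∎

  rows′ : ∀ u → count (adj B₁ u) ≡ count (adj B₂ u)
  rows′ = degrees (cong proj₁ same)

  columns′ : ∀ w → count (λ u → adj B₁ u w) ≡ count (λ u → adj B₂ u w)
  columns′ w = trans (count-cong λ u → sym (adj-transpose B₁ u w))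
    (trans (degrees {C = transpose B₁} {transpose B₂} (cong proj₂ same) w) (count-cong λ u → adj-transpose B₂ u w))

-- The bounds by m* and m

∣xor∣≤ : (p q : Subset n) → ∣ zipWith _xor_ p q ∣ ℕ.≤ ∣ p ∣ ℕ.+ ∣ q ∣
∣xor∣≤ []          []          = ℕ.z≤n
∣xor∣≤ (true ∷ p)  (true ∷ q)  = ℕ.m≤n⇒m≤1+n (ℕ.≤-trans (∣xor∣≤ p q) (ℕ.+-monoʳ-≤ ∣ p ∣ (ℕ.n≤1+n ∣ q ∣)))
∣xor∣≤ (true ∷ p)  (false ∷ q) = ℕ.s≤s (∣xor∣≤ p q)
∣xor∣≤ (false ∷ p) (true ∷ q)  = ℕ.≤-trans (ℕ.s≤s (∣xor∣≤ p q)) (ℕ.≤-reflexive (sym (ℕ.+-suc ∣ p ∣ ∣ q ∣)))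
∣xor∣≤ (false ∷ p) (false ∷ q) = ∣xor∣≤ p q

∁-xor-∁ : (p q : Subset n) → zipWith _xor_ (∁ p) (∁ q) ≡ zipWith _xor_ p q
∁-xor-∁ []      []      = refl
∁-xor-∁ (x ∷ p) (y ∷ q) = cong₂ _∷_ (Bool.xor-annihilates-not x y) (∁-xor-∁ p q)

-- A symmetric difference is at most the sum of the two sizes. Complementing both sets does not
-- change it, which gives the second term of the minimum.
∣xor∣≤2min : (p q : Subset n) → ∣ p ∣ ≡ ∣ q ∣ → ∣ zipWith _xor_ p q ∣ ℕ.≤ 2 ℕ.* (∣ p ∣ ⊓ (n ∸ ∣ p ∣))
∣xor∣≤2min {n} p q eq = begin
  ∣ zipWith _xor_ p q ∣                          ≤⟨ ℕ.⊓-glb below-degree below-codegree ⟩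
  (2 ℕ.* ∣ p ∣) ⊓ (2 ℕ.* (n ∸ ∣ p ∣))              ≡⟨ ℕ.*-distribˡ-⊓ 2 ∣ p ∣ (n ∸ ∣ p ∣) ⟨
  2 ℕ.* (∣ p ∣ ⊓ (n ∸ ∣ p ∣))                    ∎
  where
  open ℕ.≤-Reasoning
  double : ∀ {x y} (r s : Subset n) → ∣ r ∣ ≡ x → ∣ s ∣ ≡ x → ∣ zipWith _xor_ r s ∣ ≡ y → y ℕ.≤ 2 ℕ.* x
  double r s refl eq refl = ℕ.≤-trans (∣xor∣≤ r s)
    (ℕ.+-monoʳ-≤ ∣ r ∣ (ℕ.≤-reflexive (trans eq (sym (ℕ.+-identityʳ ∣ r ∣)))))

  below-degree : ∣ zipWith _xor_ p q ∣ ℕ.≤ 2 ℕ.* ∣ p ∣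
  below-degree = double p q refl (sym eq) refl

  below-codegree : ∣ zipWith _xor_ p q ∣ ℕ.≤ 2 ℕ.* (n ∸ ∣ p ∣)
  below-codegree = double (∁ p) (∁ q) (∣∁p∣≡n∸∣p∣ p) (trans (∣∁p∣≡n∸∣p∣ q) (cong (n ∸_) (sym eq)))
                     (cong ∣_∣ (∁-xor-∁ p q))

difference≤m* : (B₁ B₂ : BipartiteGraph k ℓ) → map ∣_∣ B₁ ≡ map ∣_∣ B₂ →
                edgeCount (symmetricDifference B₁ B₂) ℕ.≤ m* (map ∣_∣ B₁) ℓ
difference≤m* []       []       _ = ℕ.z≤n
difference≤m* {ℓ = ℓ} (p ∷ B₁) (q ∷ B₂) eq = begin
  ∣ zipWith _xor_ p q ∣ ℕ.+ edgeCount (symmetricDifference B₁ B₂)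
    ≤⟨ ℕ.+-mono-≤ (∣xor∣≤2min p q (∷-injectiveˡ eq)) (difference≤m* B₁ B₂ (∷-injectiveʳ eq)) ⟩
  2 ℕ.* (∣ p ∣ ⊓ (ℓ ∸ ∣ p ∣)) ℕ.+ m* (map ∣_∣ B₁) ℓ
    ≡⟨ ℕ.*-distribˡ-+ 2 (∣ p ∣ ⊓ (ℓ ∸ ∣ p ∣)) _ ⟨
  m* (map ∣_∣ (p ∷ B₁)) ℓ ∎
  where open ℕ.≤-Reasoning

m*≤2m : (as : Vec ℕ k) (ℓ : ℕ) → m* as ℓ ℕ.≤ 2 ℕ.* sum as
m*≤2m as ℓ = ℕ.*-monoʳ-≤ 2 (minima≤ as)
  where
  minima≤ : ∀ {k} (as : Vec ℕ k) → sum (map (λ a → a ⊓ (ℓ ∸ a)) as) ℕ.≤ sum as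
  minima≤ []       = ℕ.z≤n
  minima≤ (a ∷ as) = ℕ.+-mono-≤ (ℕ.m⊓n≤m a (ℓ ∸ a)) (minima≤ as)

-- Arithmetic of fractions

-- `_/_` reduces to lowest terms and so hides its numerator and denominator; the unnormalised
-- fraction keeps them, which allows comparison by cross-multiplication in ℕ.
toℚᵘ-/ : ∀ i n → toℚᵘ (+ i / suc n) ℚᵘ.≃ mkℚᵘ (+ i) n
toℚᵘ-/ i n = ℚ.toℚᵘ-fromℚᵘ (mkℚᵘ (+ i) n)

/-≤ : ∀ i j m n .{{_ : NonZero m}} .{{_ : NonZero n}} → i ℕ.* n ℕ.≤ j ℕ.* m → + i / m ≤ + j / n
/-≤ i j (suc m) (suc n) i≤j = ℚ.toℚᵘ-cancel-≤ (begin
  toℚᵘ (+ i / suc m) ≃⟨ toℚᵘ-/ i m ⟩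
  mkℚᵘ (+ i) m       ≤⟨ ℚᵘ.*≤* (subst₂ ℤ._≤_ (ℤ.pos-* i (suc n)) (ℤ.pos-* j (suc m)) (ℤ.+≤+ i≤j)) ⟩
  mkℚᵘ (+ j) n       ≃⟨ toℚᵘ-/ j n ⟨
  toℚᵘ (+ j / suc n) ∎)
  where open ℚᵘ.≤-Reasoning

/-≡ : ∀ i j m n .{{_ : NonZero m}} .{{_ : NonZero n}} → i ℕ.* n ≡ j ℕ.* m → + i / m ≡ + j / n
/-≡ i j m n eq = ℚ.≤-antisym (/-≤ i j m n (ℕ.≤-reflexive eq)) (/-≤ j i n m (ℕ.≤-reflexive (sym eq)))

/-* : ∀ i j m n .{{_ : NonZero m}} .{{_ : NonZero n}} .{{_ : NonZero (m ℕ.* n)}} →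
      (+ i / m) * (+ j / n) ≡ + (i ℕ.* j) / (m ℕ.* n)
/-* i j (suc m) (suc n) = ℚ.toℚᵘ-injective (begin-equality
  toℚᵘ ((+ i / suc m) * (+ j / suc n))          ≃⟨ ℚ.toℚᵘ-homo-* (+ i / suc m) (+ j / suc n) ⟩
  toℚᵘ (+ i / suc m) ℚᵘ.* toℚᵘ (+ j / suc n)    ≃⟨ ℚᵘ.*-cong (toℚᵘ-/ i m) (toℚᵘ-/ j n) ⟩
  mkℚᵘ (+ i) m ℚᵘ.* mkℚᵘ (+ j) n                ≡⟨ cong (λ z → mkℚᵘ z (n ℕ.+ m ℕ.* suc n)) (ℤ.pos-* i j) ⟨
  mkℚᵘ (+ (i ℕ.* j)) (n ℕ.+ m ℕ.* suc n)        ≃⟨ toℚᵘ-/ (i ℕ.* j) (n ℕ.+ m ℕ.* suc n) ⟨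
  toℚᵘ (+ (i ℕ.* j) / (suc m ℕ.* suc n))        ∎)
  where open ℚᵘ.≤-Reasoning

/-+ : ∀ i j m n .{{_ : NonZero m}} .{{_ : NonZero n}} .{{_ : NonZero (m ℕ.* n)}} →
      (+ i / m) ℚ.+ (+ j / n) ≡ + (i ℕ.* n ℕ.+ j ℕ.* m) / (m ℕ.* n)
/-+ i j (suc m) (suc n) = ℚ.toℚᵘ-injective (begin-equality
  toℚᵘ ((+ i / suc m) ℚ.+ (+ j / suc n))        ≃⟨ ℚ.toℚᵘ-homo-+ (+ i / suc m) (+ j / suc n) ⟩
  toℚᵘ (+ i / suc m) ℚᵘ.+ toℚᵘ (+ j / suc n)    ≃⟨ ℚᵘ.+-cong (toℚᵘ-/ i m) (toℚᵘ-/ j n) ⟩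
  mkℚᵘ (+ i) m ℚᵘ.+ mkℚᵘ (+ j) n                ≡⟨ cong (λ z → mkℚᵘ z (n ℕ.+ m ℕ.* suc n))
                                                     (cong₂ ℤ._+_ (ℤ.pos-* i (suc n)) (ℤ.pos-* j (suc m))) ⟨
  mkℚᵘ (+ (i ℕ.* suc n ℕ.+ j ℕ.* suc m)) (n ℕ.+ m ℕ.* suc n)
    ≃⟨ toℚᵘ-/ (i ℕ.* suc n ℕ.+ j ℕ.* suc m) (n ℕ.+ m ℕ.* suc n) ⟨
  toℚᵘ (+ (i ℕ.* suc n ℕ.+ j ℕ.* suc m) / (suc m ℕ.* suc n)) ∎)
  where open ℚᵘ.≤-Reasoning

-- Differences are certified by sums, so that all numerators remain natural numbers: with
-- `ℓ = suc l`, the factors `1 - 2/n′` and `1/2 - 1/n′` become `l/ℓ` and `l/(2ℓ)`.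
+⇒- : ∀ p q {r} → p ℚ.+ q ≡ r → r - q ≡ p
+⇒- p q refl = Algebra.Properties.Group.//-rightDividesʳ ℚ.+-0-group q p

1-2/n′ : ∀ l → 1ℚ - + 2 / (2 ℕ.* suc l) ≡ + l / suc l
1-2/n′ l = +⇒- (+ l / suc l) (+ 2 / (2 ℕ.* suc l)) (trans
  (/-+ l 2 (suc l) (2 ℕ.* suc l))
  (/-≡ (l ℕ.* (2 ℕ.* suc l) ℕ.+ 2 ℕ.* suc l) 1 (suc l ℕ.* (2 ℕ.* suc l)) 1 (eq l)))
  where
  eq : ∀ l → (l ℕ.* (2 ℕ.* suc l) ℕ.+ 2 ℕ.* suc l) ℕ.* 1 ≡ 1 ℕ.* (suc l ℕ.* (2 ℕ.* suc l))
  eq = solve-∀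

½-1/n′ : ∀ l → ½ - + 1 / (2 ℕ.* suc l) ≡ + l / (2 ℕ.* suc l)
½-1/n′ l = +⇒- (+ l / (2 ℕ.* suc l)) (+ 1 / (2 ℕ.* suc l)) (trans
  (/-+ l 1 (2 ℕ.* suc l) (2 ℕ.* suc l))
  (/-≡ (l ℕ.* (2 ℕ.* suc l) ℕ.+ 1 ℕ.* (2 ℕ.* suc l)) 1 (2 ℕ.* suc l ℕ.* (2 ℕ.* suc l)) 2 (eq l)))
  where
  eq : ∀ l → (l ℕ.* (2 ℕ.* suc l) ℕ.+ 1 ℕ.* (2 ℕ.* suc l)) ℕ.* 2 ≡ 1 ℕ.* ((2 ℕ.* suc l) ℕ.* (2 ℕ.* suc l))
  eq = solve-∀

*[1-2/n′] : ∀ l x m .{{_ : NonZero m}} .{{_ : NonZero (m ℕ.* suc l)}} →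
            (+ x / m) * (1ℚ - + 2 / (2 ℕ.* suc l)) ≡ + (x ℕ.* l) / (m ℕ.* suc l)
*[1-2/n′] l x m = trans (cong ((+ x / m) *_) (1-2/n′ l)) (/-* x l m (suc l))

*[½-1/n′] : ∀ l y → fromℕ y * (½ - + 1 / (2 ℕ.* suc l)) ≡ + (y ℕ.* l) / (1 ℕ.* (2 ℕ.* suc l))
*[½-1/n′] l y = trans (cong (fromℕ y *_) (½-1/n′ l)) (/-* y l 1 (2 ℕ.* suc l))

distance-bound : ∀ l d x → d ℕ.* suc l ℕ.* 2 ℕ.+ x ℕ.≤ x ℕ.* suc l →
                 fromℕ d ≤ (+ x / 2) * (1ℚ - + 2 / (2 ℕ.* suc l))
distance-bound l d x bound = subst (fromℕ d ≤_) (sym (*[1-2/n′] l x 2))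
  (/-≤ d (x ℕ.* l) 1 (2 ℕ.* suc l) (begin
  d ℕ.* (2 ℕ.* suc l)       ≡⟨ left d l ⟩
  -- Since `x * suc l` is `x * l + x`, cancelling `x` in the bound yields the factor `l`.
  d ℕ.* suc l ℕ.* 2         ≤⟨ ℕ.+-cancelʳ-≤ x (d ℕ.* suc l ℕ.* 2) (x ℕ.* l ℕ.* 1)
                                 (subst (d ℕ.* suc l ℕ.* 2 ℕ.+ x ℕ.≤_) (right x l) bound) ⟩
  x ℕ.* l ℕ.* 1             ∎))
  where
  open ℕ.≤-Reasoning
  left : ∀ d l → d ℕ.* (2 ℕ.* suc l) ≡ d ℕ.* suc l ℕ.* 2
  left = solve-∀
  right : ∀ x l → x ℕ.* suc l ≡ x ℕ.* l ℕ.* 1 ℕ.+ x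
  right = solve-∀

H′-bound : ∀ l x y → x ℕ.≤ y →
           (+ x / 2) * (1ℚ - + 2 / (2 ℕ.* suc l)) ≤ fromℕ y * (½ - + 1 / (2 ℕ.* suc l))
H′-bound l x y x≤y = subst₂ _≤_ (sym (*[1-2/n′] l x 2)) (sym (*[½-1/n′] l y))
  (/-≤ (x ℕ.* l) (y ℕ.* l) (2 ℕ.* suc l) (1 ℕ.* (2 ℕ.* suc l)) (begin
  x ℕ.* l ℕ.* (1 ℕ.* (2 ℕ.* suc l)) ≤⟨ ℕ.*-monoˡ-≤ (1 ℕ.* (2 ℕ.* suc l)) (ℕ.*-monoˡ-≤ l x≤y) ⟩
  y ℕ.* l ℕ.* (1 ℕ.* (2 ℕ.* suc l)) ≡⟨ cong (y ℕ.* l ℕ.*_) (ℕ.*-identityˡ (2 ℕ.* suc l)) ⟩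
  y ℕ.* l ℕ.* (2 ℕ.* suc l)         ∎))
  where open ℕ.≤-Reasoning

m*-bound : ∀ l y m → y ℕ.≤ 2 ℕ.* m →
           fromℕ y * (½ - + 1 / (2 ℕ.* suc l)) ≤ fromℕ m * (1ℚ - + 2 / (2 ℕ.* suc l))
m*-bound l y m y≤2m = subst₂ _≤_ (sym (*[½-1/n′] l y)) (sym (*[1-2/n′] l m 1))
  (/-≤ (y ℕ.* l) (m ℕ.* l) (1 ℕ.* (2 ℕ.* suc l)) (1 ℕ.* suc l) (begin
  y ℕ.* l ℕ.* (1 ℕ.* suc l)         ≤⟨ ℕ.*-monoˡ-≤ (1 ℕ.* suc l) (ℕ.*-monoˡ-≤ l y≤2m) ⟩
  2 ℕ.* m ℕ.* l ℕ.* (1 ℕ.* suc l)   ≡⟨ eq m l ⟩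
  m ℕ.* l ℕ.* (1 ℕ.* (2 ℕ.* suc l)) ∎))
  where
  open ℕ.≤-Reasoning
  eq : ∀ m l → 2 ℕ.* m ℕ.* l ℕ.* (1 ℕ.* suc l) ≡ m ℕ.* l ℕ.* (1 ℕ.* (2 ℕ.* suc l))
  eq = solve-∀

-- The distance and the chain of inequalities

swapDistance : .{{NonZero ℓ}} → (B₁ B₂ : BipartiteGraph k ℓ) → degreeSequence B₁ ≡ degreeSequence B₂ →
               let x = edgeCount (symmetricDifference B₁ B₂) in
               ∃[ d ] IsSwapDistance B₁ B₂ d × d ℕ.* ℓ ℕ.* 2 ℕ.+ x ℕ.≤ x ℕ.* ℓ
swapDistance {ℓ = ℓ} B₁ B₂ same
  with reach (adj B₂) _ (adj B₁) (realizations-SameDegrees same)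
         (trans (sym (total-cong (adj-symmetricDifference B₁ B₂))) (sym (edgeCount-total (symmetricDifference B₁ B₂))))
... | n , s , bound
  with least (λ n → swapSequence? n B₁ B₂) n
         (subst₂ (λ B B′ → SwapSequence B B′ n) (toGraph∘adj B₁) (toGraph∘adj B₂) s)
...   | d , attained , d≤n , minimal =
  d , record { attained = attained ; minimal = minimal }
    -- The bound was proved for the sequence that flips cycles, and the shortest sequence inherits
    -- it.
    , ℕ.≤-trans (ℕ.+-monoˡ-≤ _ (ℕ.*-monoˡ-≤ 2 (ℕ.*-monoˡ-≤ ℓ d≤n))) bound

theorem4p1 : ∀ (k ℓ : ℕ) .{{ℓ≢0 : NonZero ℓ}} (as : Vec ℕ k) (bs : Vec ℕ ℓ) →
    ℓ ℕ.≤ k →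
    (B₁ B₂ : BipartiteGraph k ℓ) →
    Realizes B₁ (as , bs) →
    Realizes B₂ (as , bs) →
    let n′ = 2 ℕ.* ℓ
        instance n′≢0 = m*n≢0 2 ℓ
        m = sum as
    in ∃[ d ] IsSwapDistance B₁ B₂ d
    × fromℕ d ≤ H′ B₁ B₂ * (1ℚ - + 2 / n′)
    × H′ B₁ B₂ * (1ℚ - + 2 / n′) ≤ fromℕ (m* as ℓ) * (½ - + 1 / n′)
    × fromℕ (m* as ℓ) * (½ - + 1 / n′) ≤ fromℕ m * (1ℚ - + 2 / n′)
theorem4p1 k ℓ@(suc l) as bs _ B₁ B₂ real₁ real₂ with swapDistance B₁ B₂ (trans real₁ (sym real₂))
... | d , dist , bound =
  d , dist , distance-bound l d x bound , H′-bound l x (m* as ℓ) difference≤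
    , m*-bound l (m* as ℓ) (sum as) (m*≤2m as ℓ)
  where
  x : ℕ
  x = edgeCount (symmetricDifference B₁ B₂)

  difference≤ : x ℕ.≤ m* as ℓ
  difference≤ = subst (λ as → x ℕ.≤ m* as ℓ) (cong proj₁ real₁)
    (difference≤m* B₁ B₂ (cong proj₁ (trans real₁ (sym real₂))))
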